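{- For every Korselt number ($KN$), $r\le \frac12(P-1)(P+1)^2+1$, with equality if and only if $q=P^2+P-1$.
   Context: A Korselt number ($KN$) is an integer $n$ together with a factorisation $n=\prod_{i=1}^d p_i$, where $d\ge 3$ and $1<p_1<p_2<\dots<p_d$ are odd integers (not necessarily prime), such that $p_i-1$ divides $n-1$ for every $i$, and such that $E:=\dfrac{n/p_d-1}{p_d-1}$ (which is an integer by the divisibility condition) satisfies $E\ge 2$. Notation: $P:=\prod_{i=1}^{d-2}p_i$, $q:=p_{d-1}$, $r:=p_d$, so that $n=Pqr$. -}

module Defs where

open import Data.Fin.Base as Fin using (fromℕ; inject₁)
open import Data.Nat.Base
open import Data.Nat.Divisibility using (_∣_; _∤_)
open import Data.Nat.DivMod using (_/_)
open import Data.Nat.Properties using (<⇒≤; m<n⇒0<n∸m)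
open import Data.Vec.Functional using (Vector; foldr)
open import Function.Base using (_∘_)
open import Relation.Binary.PropositionalEquality using (_≡_)

∏ : ∀ {k} → Vector ℕ k → ℕ
∏ = foldr _*_ 1

-- Both divisions are exact in a Korselt number with largest factor r: r
-- divides n, and r - 1 divides n/r - 1 because
-- n - 1 = (n/r)(r - 1) + (n/r - 1).
E : (n r : ℕ) → 1 < r → ℕ
E n r 1<r = (n / r ∸ 1) / (r ∸ 1)
  where
  instance
    r≢0 : NonZero r
    r≢0 = >-nonZero (<⇒≤ 1<r)
    r∸1≢0 : NonZero (r ∸ 1)
    r∸1≢0 = >-nonZero (m<n⇒0<n∸m 1<r)

-- The number d = 3 + m of factors ranges over all d ≥ 3, and p is indexed
-- from 0. The factors are positive, so nothing is lost by working in ℕ, and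
-- the truncated subtractions never truncate.
record KorseltNumber : Set where
  field
    n m : ℕ
    p   : Vector ℕ (3 + m)
    factorisation : n ≡ ∏ p
    1<p           : ∀ i → 1 < p i
    increasing    : ∀ {i j} → i Fin.< j → p i < p j
    odd           : ∀ i → 2 ∤ p i
    korselt       : ∀ i → p i ∸ 1 ∣ n ∸ 1
    E≥2           : E n (p (fromℕ (2 + m))) (1<p (fromℕ (2 + m))) ≥ 2

  P q r : ℕ
  P = ∏ {1 + m} (p ∘ inject₁ ∘ inject₁)
  q = p (inject₁ (fromℕ (1 + m)))
  r = p (fromℕ (2 + m))

{-# OPTIONS --safe #-}
module Submission where

-- Put Q = q - 1, R = r - 1 and let D be the integer (Pr - 1)/Q. Then
-- E R = P Q + (P - 1) and D Q = P R + (P - 1), and eliminating Q (respectively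
-- R) gives C R = (P - 1)(P + D) and C Q = (P - 1)(P + E), where
-- C = D E - P² ≥ 1. Hence E C R = (P - 1)(P E + P² + C), and C ≥ 1, E ≥ 2 bound
-- R by its value (P - 1)(P + 1)²/2 at C = 1, E = 2, where Q = (P - 1)(P + 2).
-- Since q < r forces E < P, that value of Q in turn forces C = 1 and E = 2.

open import Algebra.Properties.Monoid.Sum using (sum-init-last)
open import Data.Nat.Base
open import Data.Nat.Divisibility
open import Data.Nat.DivMod using (_/_; m*n/n≡m; m/n*n≡m; /-monoˡ-≤)
open import Data.Nat.Properties
open import Data.Nat.Tactic.RingSolver using (solve-∀)
open import Data.Fin.Base using (zero; suc; fromℕ; inject₁)
open import Data.Fin.Properties using (toℕ-inject₁)
open import Data.Product.Base using (_×_; _,_; proj₁; proj₂)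
open import Data.Vec.Functional using (Vector)
open import Defs
open import Function.Base using (_∘_)
open import Function.Bundles using (_⇔_; mk⇔)
open import Function.Construct.Composition using (_⇔-∘_)
open import Function.Construct.Symmetry using (⇔-sym)
open import Relation.Nullary.Negation using (contradiction)
open import Relation.Binary.PropositionalEquality

∏-init-last : ∀ {k} (p : Vector ℕ (suc k)) → ∏ p ≡ ∏ (p ∘ inject₁) * p (fromℕ k)
∏-init-last = sum-init-last *-1-monoid

0<∏ : ∀ {k} (p : Vector ℕ k) → (∀ i → 1 < p i) → 0 < ∏ p
0<∏ {zero}  p 1<p = s≤s z≤n
0<∏ {suc k} p 1<p = *-mono-≤ (<⇒≤ (1<p zero)) (0<∏ (p ∘ suc) (1<p ∘ suc))

1<∏ : ∀ {k} (p : Vector ℕ (suc k)) → (∀ i → 1 < p i) → 1 < ∏ p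
1<∏ p 1<p = *-mono-≤ (1<p zero) (0<∏ (p ∘ suc) (1<p ∘ suc))

-- Since m r - 1 = m (r - 1) + (m - 1), the divisor also divides m - 1. This makes both `E` and the
-- D of the overview integers.
∣-cofactor∸1 : ∀ m {r} .{{_ : NonZero m}} .{{_ : NonZero r}} →
               r ∸ 1 ∣ m * r ∸ 1 → r ∸ 1 ∣ m ∸ 1
∣-cofactor∸1 (suc k) {suc R} R∣ =
  ∣m+n∣m⇒∣n (subst (R ∣_) (regroup k R) R∣) (n∣m*n (suc k))
  where
  regroup : ∀ k R → R + k * suc R ≡ suc k * R + k
  regroup = solve-∀

E-exact : ∀ m r .{{_ : NonZero m}} (1<r : 1 < r) → r ∸ 1 ∣ m * r ∸ 1 →
          E (m * r) r 1<r * (r ∸ 1) ≡ m ∸ 1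
E-exact m (suc zero)      (s≤s ()) _
E-exact m (suc R@(suc _)) 1<r      R∣ = begin
  (m * suc R / suc R ∸ 1) / R * R  ≡⟨ cong (λ x → (x ∸ 1) / R * R) (m*n/n≡m m (suc R)) ⟩
  (m ∸ 1) / R * R                  ≡⟨ m/n*n≡m (∣-cofactor∸1 m R∣) ⟩
  m ∸ 1                            ∎
  where open ≡-Reasoning

2∤1+n⇒2∣n : ∀ n → 2 ∤ suc n → 2 ∣ n
2∤1+n⇒2∣n zero          _   = 2 ∣0
2∤1+n⇒2∣n (suc zero)    2∤2 = contradiction ∣-refl 2∤2
2∤1+n⇒2∣n (suc (suc n)) 2∤  =
  ∣m∣n⇒∣m+n ∣-refl (2∤1+n⇒2∣n n (2∤ ∘ ∣m∣n⇒∣m+n ∣-refl))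

n*2≡m⇔n≡m/2 : ∀ {m} n → 2 ∣ m → n * 2 ≡ m ⇔ n ≡ m / 2
n*2≡m⇔n≡m/2 n 2∣m = mk⇔
  (λ n*2≡m → trans (sym (m*n/n≡m n 2)) (cong (_/ 2) n*2≡m))
  (λ n≡m/2 → trans (cong (_* 2) n≡m/2) (m/n*n≡m 2∣m))

eliminate : ∀ P a D E {Q R} → E * R ≡ P * Q + a → D * Q ≡ P * R + a →
            D * E * R ≡ P * P * R + (P + D) * a
eliminate P a D E {Q} {R} ER DQ = begin
  D * E * R                  ≡⟨ *-assoc D E R ⟩
  D * (E * R)                ≡⟨ cong (D *_) ER ⟩
  D * (P * Q + a)            ≡⟨ swap D P Q a ⟩
  P * (D * Q) + D * a        ≡⟨ cong (λ x → P * x + D * a) DQ ⟩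
  P * (P * R + a) + D * a    ≡⟨ collect P R a D ⟩
  P * P * R + (P + D) * a    ∎
  where
  open ≡-Reasoning
  swap : ∀ D P Q a → D * (P * Q + a) ≡ P * (D * Q) + D * a
  swap = solve-∀
  collect : ∀ P R a D → P * (P * R + a) + D * a ≡ P * P * R + (P + D) * a
  collect = solve-∀

-- The parameters are a = P - 1, e = E - 2, c = C - 1, Q = q - 1 and R = r - 1.
module _ (a e c D Q R : ℕ) .{{_ : NonZero a}} where
  private
    P E′ C X slack : ℕ
    P     = suc a
    E′    = 2 + e
    C     = 1 + c
    X     = a * (P + 1) ^ 2
    -- The difference between the two sides of the bound, scaled by `E′ * C`. Expanding in `e` and
    -- `c` leaves no negative coefficient, so the bound needs no subtraction.
    slack = ((e + 2 * c + e * c) * (P * P) + c * (2 * E′ * P) + e * C) * a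

  module _ (DE : D * E′ ≡ P * P + C)
           (CR : C * R ≡ (P + D) * a) (CQ : C * Q ≡ (P + E′) * a) where

    -- `DE` turns `E′ * (P + D)` into `E′ * P + P * P + C`, so `D` drops out and a polynomial
    -- identity in `a`, `e`, `c` remains.
    slack-identity : E′ * C * X ≡ E′ * C * (R * 2) + slack
    slack-identity = begin
      E′ * C * X                                ≡⟨ expand a e c ⟩
      2 * ((E′ * P + (P * P + C)) * a) + slack  ≡⟨ cong (λ x → 2 * ((E′ * P + x) * a) + slack) DE ⟨
      2 * ((E′ * P + D * E′) * a) + slack       ≡⟨ cong (_+ slack) (factor E′ P D a) ⟩
      2 * (E′ * ((P + D) * a)) + slack          ≡⟨ cong (λ x → 2 * (E′ * x) + slack) CR ⟨
      2 * (E′ * (C * R)) + slack                ≡⟨ cong (_+ slack) (reorder E′ C R) ⟩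
      E′ * C * (R * 2) + slack                  ∎
      where
      open ≡-Reasoning
      expand : ∀ a e c → let P = suc a; E = 2 + e; C = 1 + c in
        E * C * (a * ((P + 1) * ((P + 1) * 1))) ≡
        2 * ((E * P + (P * P + C)) * a) +
        ((e + 2 * c + e * c) * (P * P) + c * (2 * E * P) + e * C) * a
      expand = solve-∀
      factor : ∀ E P D a → 2 * ((E * P + D * E) * a) ≡ 2 * (E * ((P + D) * a))
      factor = solve-∀
      reorder : ∀ E C R → 2 * (E * (C * R)) ≡ E * C * (R * 2)
      reorder = solve-∀

    R*2≤X : R * 2 ≤ X
    R*2≤X = *-cancelˡ-≤ (E′ * C)
      (≤-trans (m≤m+n _ slack) (≤-reflexive (sym slack-identity)))

    -- Equality makes `slack` vanish, hence each of its summands, as `a` is nonzero. The summands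
    -- `e * C` and `c * (2 * E′ * P)` have positive cofactors of `e` and `c`.
    R*2≡X⇒e≡0×c≡0 : R * 2 ≡ X → e ≡ 0 × c ≡ 0
    R*2≡X⇒e≡0×c≡0 R*2≡X =
        m*n≡0⇒m≡0 e C (m+n≡0⇒n≡0 (u + v) sum≡0)
      , m*n≡0⇒m≡0 c (2 * E′ * P) (m+n≡0⇒n≡0 u (m+n≡0⇒m≡0 (u + v) sum≡0))
      where
      u v : ℕ
      u = (e + 2 * c + e * c) * (P * P)
      v = c * (2 * E′ * P)
      slack≡0 : slack ≡ 0
      slack≡0 = +-cancelˡ-≡ (E′ * C * (R * 2)) slack 0
        (trans (sym slack-identity)
          (trans (cong (E′ * C *_) (sym R*2≡X)) (sym (+-identityʳ _))))
      sum≡0 : u + v + e * C ≡ 0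
      sum≡0 = m*n≡0⇒m≡0 _ a slack≡0

    e≡0×c≡0⇒R*2≡X : e ≡ 0 × c ≡ 0 → R * 2 ≡ X
    e≡0×c≡0⇒R*2≡X (refl , refl) = *-cancelˡ-≡ (R * 2) X 2
      (sym (trans slack-identity (+-identityʳ _)))

    e≡0×c≡0⇒Q≡ : e ≡ 0 × c ≡ 0 → Q ≡ (P + 2) * a
    e≡0×c≡0⇒Q≡ (refl , refl) = trans (sym (+-identityʳ Q)) CQ

    -- Cancelling `a` in `CQ` leaves (1 + c)(P + 2) = P + 2 + e, so `e` is a multiple of P + 2;
    -- being smaller than P + 2, it is 0.
    Q≡⇒e≡0×c≡0 : E′ < P → Q ≡ (P + 2) * a → e ≡ 0 × c ≡ 0
    Q≡⇒e≡0×c≡0 E<P Q≡ = e≡0 , c≡0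
      where
      C[P+2]≡P+E : C * (P + 2) ≡ P + E′
      C[P+2]≡P+E = *-cancelʳ-≡ _ _ a
        (trans (*-assoc C (P + 2) a) (trans (cong (C *_) (sym Q≡)) CQ))
      c[P+2]≡e : c * (P + 2) ≡ e
      c[P+2]≡e = +-cancelˡ-≡ (P + 2) _ _ (trans C[P+2]≡P+E (sym (+-assoc P 2 e)))
      e<P+2 : e < P + 2
      e<P+2 = ≤-trans (s≤s (m≤n+m e 2)) (≤-trans E<P (m≤m+n P 2))
      c≡0 : c ≡ 0
      c≡0 = n<1⇒n≡0 (*-cancelʳ-< (P + 2) c 1
        (subst₂ _<_ (sym c[P+2]≡e) (sym (*-identityˡ (P + 2))) e<P+2))
      e≡0 : e ≡ 0
      e≡0 = trans (sym c[P+2]≡e) (cong (_* (P + 2)) c≡0)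

    R*2≡X⇔Q≡ : E′ < P → R * 2 ≡ X ⇔ Q ≡ (P + 2) * a
    R*2≡X⇔Q≡ E<P = mk⇔ (e≡0×c≡0⇒Q≡ ∘ R*2≡X⇒e≡0×c≡0)
                        (e≡0×c≡0⇒R*2≡X ∘ Q≡⇒e≡0×c≡0 E<P)

-- With P = a + 1, E R = P Q + P - 1 < P (Q + 1) ≤ P R.
E<P : ∀ a E {Q R} → Q < R → E * R ≡ suc a * Q + a → E < suc a
E<P a E {Q} {R} Q<R ER = *-cancelʳ-< R E (suc a) (begin-strict
  E * R              ≡⟨ ER ⟩
  suc a * Q + a      <⟨ +-monoʳ-< (suc a * Q) (n<1+n a) ⟩
  suc a * Q + suc a  ≡⟨ +-comm (suc a * Q) (suc a) ⟩
  suc a + suc a * Q  ≡⟨ *-suc (suc a) Q ⟨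
  suc a * suc Q      ≤⟨ *-monoʳ-≤ (suc a) Q<R ⟩
  suc a * R          ∎)
  where open ≤-Reasoning

bound : ∀ a e D Q R .{{_ : NonZero a}} → Q < R →
        (2 + e) * R ≡ suc a * Q + a → D * Q ≡ suc a * R + a →
        let X = a * (suc a + 1) ^ 2 in
        R * 2 ≤ X × (R * 2 ≡ X ⇔ Q ≡ (suc a + 2) * a)
bound a e D Q R Q<R ER DQ =
    R*2≤X    a e c D Q R DE CR CQ
  , R*2≡X⇔Q≡ a e c D Q R DE CR CQ (E<P a E′ Q<R ER)
  where
  P E′ : ℕ
  P  = suc a
  E′ = 2 + e
  DER : D * E′ * R ≡ P * P * R + (P + D) * a
  DER = eliminate P a D E′ ER DQ
  EDQ : E′ * D * Q ≡ P * P * Q + (P + E′) * a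
  EDQ = eliminate P a E′ D DQ ER
  -- By `DER`, (D E - P²) R = (P + D)(P - 1), which is positive.
  PP<DE : P * P < D * E′
  PP<DE = *-cancelʳ-< R (P * P) (D * E′)
    (subst (P * P * R <_) (sym DER)
      (m<m+n (P * P * R) (*-mono-≤ {1} {P + D} (s≤s z≤n) (>-nonZero⁻¹ a))))
  c : ℕ
  c = proj₁ (m≤n⇒∃[o]m+o≡n PP<DE)
  DE : D * E′ ≡ P * P + suc c
  DE = trans (sym (proj₂ (m≤n⇒∃[o]m+o≡n PP<DE))) (sym (+-suc (P * P) c))
  cancel : ∀ {x} S → D * E′ * S ≡ P * P * S + x → suc c * S ≡ x
  cancel S DES = +-cancelˡ-≡ (P * P * S) _ _
    (trans (sym (*-distribʳ-+ S (P * P) (suc c)))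
      (trans (cong (_* S) (sym DE)) DES))
  CR : suc c * R ≡ (P + D) * a
  CR = cancel R DER
  CQ : suc c * Q ≡ (P + E′) * a
  CQ = cancel Q (trans (cong (_* Q) (*-comm D E′)) EDQ)

korselt-bound : ∀ P q r ε → 1 < P → q < r → 2 ∤ q → 2 ∤ r → 2 ≤ ε →
                ε * (r ∸ 1) ≡ P * q ∸ 1 → q ∸ 1 ∣ P * r ∸ 1 →
                (r ≤ (P ∸ 1) * (P + 1) ^ 2 / 2 + 1) ×
                ((r ≡ (P ∸ 1) * (P + 1) ^ 2 / 2 + 1) ⇔ (q ≡ P ^ 2 + P ∸ 1))
korselt-bound _ zero _ _ _ _ 2∤q _ _ _ _ = contradiction (2 ∣0) 2∤q
korselt-bound (suc zero) (suc _) _ _ (s≤s ()) _ _ _ _ _ _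
korselt-bound (suc a@(suc _)) (suc Q) (suc R) (suc (suc e)) _ (s≤s Q<R) 2∤q 2∤r
              (s≤s (s≤s _)) ER (divides D DQ) =
    subst (suc R ≤_) (+-comm 1 (X / 2)) (s≤s R≤X/2)
  , (q-form ⇔-∘ (proj₂ R*2-bound ⇔-∘ ⇔-sym (n*2≡m⇔n≡m/2 R 2∣X))) ⇔-∘ r-form
  where
  X : ℕ
  X = a * (suc a + 1) ^ 2
  regroup : ∀ a Q → Q + a * suc Q ≡ suc a * Q + a
  regroup = solve-∀
  DQ′ : D * Q ≡ suc a * R + a
  DQ′ = trans (sym DQ) (regroup a R)
  R*2-bound : R * 2 ≤ X × (R * 2 ≡ X ⇔ Q ≡ (suc a + 2) * a)
  R*2-bound = bound a e D Q R Q<R (trans ER (regroup a Q)) DQ′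
  -- Halving `X` is exact because a = P - 1 is even: a = D Q - P R, where Q and R are even since q
  -- and r are odd.
  2∣X : 2 ∣ X
  2∣X = ∣m⇒∣m*n ((suc a + 1) ^ 2)
    (∣m+n∣m⇒∣n (subst (2 ∣_) DQ′ (∣n⇒∣m*n D (2∤1+n⇒2∣n Q 2∤q)))
               (∣n⇒∣m*n (suc a) (2∤1+n⇒2∣n R 2∤r)))
  R≤X/2 : R ≤ X / 2
  R≤X/2 = subst (_≤ X / 2) (m*n/n≡m R 2) (/-monoˡ-≤ 2 (proj₁ R*2-bound))
  r-form : suc R ≡ X / 2 + 1 ⇔ R ≡ X / 2
  r-form = mk⇔ (λ eq → suc-injective (trans eq (+-comm (X / 2) 1)))
               (λ eq → trans (cong suc eq) (+-comm 1 (X / 2)))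
  -- That is, P² + P - 2 = (P + 2)(P - 1). The left side is the unfolded `suc a ^ 2 + suc a`, and
  -- the outer `suc` on the right absorbs the truncated subtraction.
  P²+P-1 : ∀ a → suc a * (suc a * 1) + suc a ≡ suc (suc ((suc a + 2) * a))
  P²+P-1 = solve-∀
  q-form : Q ≡ (suc a + 2) * a ⇔ suc Q ≡ suc a ^ 2 + suc a ∸ 1
  q-form = mk⇔ (λ eq → trans (cong suc eq) (sym (cong (_∸ 1) (P²+P-1 a))))
               (λ eq → suc-injective (trans eq (cong (_∸ 1) (P²+P-1 a))))

theorem3p2 : (K : KorseltNumber) → let open KorseltNumber K in
    (r ≤ (P ∸ 1) * (P + 1) ^ 2 / 2 + 1) ×
    ((r ≡ (P ∸ 1) * (P + 1) ^ 2 / 2 + 1) ⇔ (q ≡ P ^ 2 + P ∸ 1))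
theorem3p2 K = korselt-bound P q r (E n r 1<r) 1<P q<r (odd _) (odd _) E≥2
  E[r-1]≡Pq-1 (∣-cofactor∸1 (P * r) (subst (λ x → q ∸ 1 ∣ x ∸ 1) n≡Prq (korselt _)))
  where
  open KorseltNumber K
  1<r : 1 < r
  1<r = 1<p _
  1<P : 1 < P
  1<P = 1<∏ (p ∘ inject₁ ∘ inject₁) (λ i → 1<p _)
  q<r : q < r
  q<r = increasing (s≤s (≤-reflexive (toℕ-inject₁ (fromℕ (1 + m)))))
  n≡Pqr : n ≡ P * q * r
  n≡Pqr = trans factorisation
    (trans (∏-init-last p) (cong (_* r) (∏-init-last (p ∘ inject₁))))
  -- Moving q to the end makes P r its cofactor, so q - 1 divides P r - 1; the quotient is D.
  n≡Prq : n ≡ P * r * q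
  n≡Prq = trans n≡Pqr
    (trans (*-assoc P q r) (trans (cong (P *_) (*-comm q r)) (sym (*-assoc P r q))))
  instance
    P≢0 : NonZero P
    P≢0 = >-nonZero (<⇒≤ 1<P)
    q≢0 : NonZero q
    q≢0 = >-nonZero (<⇒≤ (1<p _))
    r≢0 : NonZero r
    r≢0 = >-nonZero (<⇒≤ 1<r)
    Pq≢0 : NonZero (P * q)
    Pq≢0 = m*n≢0 P q
    Pr≢0 : NonZero (P * r)
    Pr≢0 = m*n≢0 P r
  E[r-1]≡Pq-1 : E n r 1<r * (r ∸ 1) ≡ P * q ∸ 1
  E[r-1]≡Pq-1 = trans (cong (λ x → E x r 1<r * (r ∸ 1)) n≡Pqr)
    (E-exact (P * q) r 1<r (subst (λ x → r ∸ 1 ∣ x ∸ 1) n≡Pqr (korselt _)))
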